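{- Any graph $G$ obtained from a Halin tree $T$ by isomorphic leaf matching is a minimal bipartite matching covered graph that is $2$-vertex extremal. Furthermore: (i) if $T$ is a cubic Halin tree then $G$ is also $2$-vertex $n$-extremal, whereas (ii) if $T$ is a star then $G$ is also edge extremal.
   Context: All graphs are finite and loopless; parallel edges are allowed. For a graph $G=(V,E)$ write $n=|V|$ and $m=|E|$. A connected graph on four or more vertices is matching covered if every edge lies in some perfect matching. A matching covered graph is minimal if deleting any single edge yields a graph that is not matching covered. $V_2$ denotes the set of vertices of degree two. A minimal bipartite matching covered graph is: $2$-vertex extremal if $|V_2|=2(m-n+2)$; $2$-vertex $n$-extremal if $|V_2|=\frac n2+2$; edge extremal if $|E|=\frac{3n-6}{2}$. A Halin tree is a tree on at least two vertices with no vertex of degree two, i.e. all of whose non-leaves have degree at least three ($K_2$, both of whose vertices are leaves, is the smallest Halin tree). It is cubic if all its non-leaves have degree exactly three. A star is $K_{1,p}$ with $p\geq 2$ (so a star that is a Halin tree has $p\ge 3$). A graph $H$ is obtained from a tree $T$ (on at least two vertices) by isomorphic leaf matching if, for a disjoint copy $T'$ of $T$ and some fixed isomorphism from $T$ to $T'$, $H$ is obtained from $T\cup T'$ by adding, for each leaf of $T$, one edge joining this leaf to the corresponding leaf of $T'$ under the isomorphism. -}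

module Defs where

open import Data.Bool.Base using (Bool)
open import Data.Fin.Base using (Fin; zero; suc; punchIn)
open import Data.Fin.Properties using (_≟_)
open import Data.Fin.Subset using (Subset; _∈_)
open import Data.Integer.Base as ℤ using (+_)
open import Data.List.Base using (List; []; _∷_; length; filter; allFin)
open import Data.List.Relation.Unary.Unique.Propositional using (Unique)
open import Data.Nat.Base using (ℕ; suc; pred; _≤_; _<_)
import Data.Nat.Properties as ℕ
open import Data.Product using (Σ; Σ-syntax; ∃-syntax; ∃!; _×_; _,_; proj₁; proj₂)
open import Data.Rational.Unnormalised.Base as ℚ using (_≃_; _/_)
open import Data.Sum.Base using (_⊎_; inj₁; inj₂)
open import Function.Base using (_∘_)
open import Function.Bundles using (_↔_; Inverse)
open import Level using (0ℓ)
open import Relation.Binary.PropositionalEquality using (_≡_; _≢_)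
open import Relation.Nullary using (¬_)
open import Relation.Nullary.Decidable using (_⊎-dec_)
open import Relation.Unary using (Pred; Decidable)

private variable
  n m n′ m′ : ℕ

-- Loopless multigraphs with vertex set Fin n and edge set Fin m.  The order
-- of the two components of `ends e` carries no meaning: everything below
-- accesses it through Incident or Joins, except bipartiteness, which is
-- symmetric in the two ends.
record Graph (n m : ℕ) : Set where
  field
    ends     : Fin m → Fin n × Fin n
    loopless : ∀ e → proj₁ (ends e) ≢ proj₂ (ends e)

open Graph public

Incident : Graph n m → Fin n → Fin m → Set
Incident G v e = v ≡ proj₁ (ends G e) ⊎ v ≡ proj₂ (ends G e)

incident? : (G : Graph n m) (v : Fin n) → Decidable (Incident G v)
incident? G v e = (v ≟ proj₁ (ends G e)) ⊎-dec (v ≟ proj₂ (ends G e))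

Joins : Graph n m → Fin m → Fin n → Fin n → Set
Joins G e u v = ends G e ≡ (u , v) ⊎ ends G e ≡ (v , u)

count : {P : Pred (Fin n) 0ℓ} → Decidable P → ℕ
count {n} P? = length (filter P? (allFin n))

-- There are no loops, so counting incident edges gives the degree.
degree : Graph n m → Fin n → ℕ
degree G v = count (incident? G v)

∣V₂∣ : Graph n m → ℕ
∣V₂∣ G = count (λ v → degree G v ℕ.≟ 2)

delete : Graph n m → Fin m → Graph n (pred m)
delete {m = suc _} G e = record
  { ends     = ends G ∘ punchIn e
  ; loopless = loopless G ∘ punchIn e
  }

infix 4 _≅_

record _≅_ (G : Graph n m) (H : Graph n′ m′) : Set where
  field
    vertex : Fin n ↔ Fin n′
    edge   : Fin m ↔ Fin m′
    joins  : ∀ {e u v} → Joins G e u v →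
             Joins H (Inverse.to edge e) (Inverse.to vertex u) (Inverse.to vertex v)

data Walk (G : Graph n m) : Fin n → Fin n → Set where
  nil  : ∀ {u} → Walk G u u
  cons : ∀ {u v w} (e : Fin m) → Joins G e u v → Walk G v w → Walk G u w

module _ {G : Graph n m} where

  edges : ∀ {u v} → Walk G u v → List (Fin m)
  edges nil          = []
  edges (cons e _ w) = e ∷ edges w

  -- All visited vertices except the final one.
  sources : ∀ {u v} → Walk G u v → List (Fin n)
  sources nil              = []
  sources (cons {u} _ _ w) = u ∷ sources w

  -- Two parallel edges form a cycle of length two; distinctness of edges
  -- rules out traversing one edge back and forth.
  record IsCycle {u} (w : Walk G u u) : Set where
    field
      nonempty         : 0 < length (edges w)
      distinctEdges    : Unique (edges w)
      distinctVertices : Unique (sources w)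

Connected : Graph n m → Set
Connected G = ∀ u v → Walk G u v

Acyclic : Graph n m → Set
Acyclic G = ∀ {u} (w : Walk G u u) → ¬ IsCycle w

IsTree : Graph n m → Set
IsTree G = Connected G × Acyclic G

Bipartite : Graph n m → Set
Bipartite {n} G =
  Σ[ colour ∈ (Fin n → Bool) ] ∀ e → colour (proj₁ (ends G e)) ≢ colour (proj₂ (ends G e))

IsPerfectMatching : Graph n m → Subset m → Set
IsPerfectMatching G M = ∀ v → ∃! _≡_ λ e → e ∈ M × Incident G v e

record MatchingCovered (G : Graph n m) : Set where
  field
    fourVertices : 4 ≤ n
    connected    : Connected G
    covered      : ∀ e → ∃[ M ] (IsPerfectMatching G M × e ∈ M)

record MinimalBipartiteMatchingCovered (G : Graph n m) : Set where
  field
    matchingCovered : MatchingCovered G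
    minimal         : ∀ e → ¬ MatchingCovered (delete G e)
    bipartite       : Bipartite G

TwoVertexExtremal : Graph n m → Set
TwoVertexExtremal {n} {m} G = + ∣V₂∣ G ≡ + 2 ℤ.* (+ m ℤ.- + n ℤ.+ + 2)

TwoVertexNExtremal : Graph n m → Set
TwoVertexNExtremal {n} G = + ∣V₂∣ G / 1 ≃ + n / 2 ℚ.+ + 2 / 1

EdgeExtremal : Graph n m → Set
EdgeExtremal {n} {m} G = + m / 1 ≃ (+ 3 ℤ.* + n ℤ.- + 6) / 2

IsLeaf : Graph n m → Fin n → Set
IsLeaf T v = degree T v ≡ 1

record IsHalinTree {n m : ℕ} (T : Graph n m) : Set where
  field
    tree        : IsTree T
    twoVertices : 2 ≤ n
    noDegreeTwo : ∀ v → degree T v ≢ 2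

IsCubic : Graph n m → Set
IsCubic T = ∀ v → ¬ IsLeaf T v → degree T v ≡ 3

K₁,_ : ∀ p → Graph (suc p) p
K₁, p = record
  { ends     = λ i → zero , suc i
  ; loopless = λ _ ()
  }

IsStar : Graph n m → Set
IsStar T = ∃[ p ] (2 ≤ p × T ≅ K₁, p)

-- G is, up to relabelling, the disjoint union of T and its copy T′ together
-- with one further edge for each leaf of T.
record IsomorphicLeafMatching (T : Graph n m) (G : Graph n′ m′) : Set where
  field
    {k l}  : ℕ
    T′     : Graph k l
    copy   : T ≅ T′
    vertex : (Fin n ⊎ Fin k) ↔ Fin n′
    edge   : (Fin m ⊎ Fin l ⊎ Σ (Fin n) (IsLeaf T)) ↔ Fin m′

  φ : Fin n → Fin k
  φ = Inverse.to (_≅_.vertex copy)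

  private
    V = Inverse.to vertex
    E = Inverse.to edge

  field
    joinsT  : ∀ {e u v} → Joins T e u v →
              Joins G (E (inj₁ e)) (V (inj₁ u)) (V (inj₁ v))
    joinsT′ : ∀ {e u v} → Joins T′ e u v →
              Joins G (E (inj₂ (inj₁ e))) (V (inj₂ u)) (V (inj₂ v))
    joinsLeaves : ∀ {v} (leaf : IsLeaf T v) →
              Joins G (E (inj₂ (inj₂ (v , leaf)))) (V (inj₁ v)) (V (inj₂ (φ v)))

module Submission where

-- Deleting an edge e of a tree splits its vertices into two sides. These cuts
-- give the 2-colouring (the parity of the number of cuts on whose far side a
-- vertex lies) and, once a root is fixed, the parent structure, whence m + 1 = n
-- and a greedy matching built downwards from the root. The latter covers all
-- non-leaves and may be forced to use a given edge or to miss a given leaf; two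
-- mirror images of it together with the rungs at the uncovered leaves form a
-- perfect matching of G, so G is matching covered. If G − e were matching covered
-- for a tree edge e, then a perfect matching through the twin of e would contain
-- exactly one edge leaving an even vertex set; and without its rung a leaf has
-- degree one. The extremality claims amount to counting leaves by the handshake
-- lemma.

open import Defs
open import Algebra.Bundles using (CommutativeMonoid; CommutativeRing)
import Algebra.Properties.CommutativeMonoid.Sum as MonoidSum
import Algebra.Properties.Semiring.Sum as SemiringSum
open import Data.Bool.Base using (Bool; true; false; not; _∧_; _xor_; if_then_else_)
open import Data.Bool.Properties using (xor-∧-commutativeRing; xor-same; not-¬; ¬-not; not-injective; ∧-zeroʳ; ∧-identityʳ; ∧-distribˡ-xor)
  renaming (_≟_ to _≟ᵇ_)
open import Data.Empty using (⊥-elim)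
open import Data.Fin.Base using (Fin; zero; suc; punchIn; punchOut; splitAt)
open import Data.Fin.Permutation using (↔⇒≡)
open import Data.Fin.Properties using (_≟_; any?; injective⇒≤; suc-injective; punchInᵢ≢i; punchIn-punchOut; +↔⊎)
open import Data.Fin.Subset using (_∈_)
open import Data.Fin.Subset.Properties using (_∈?_)
import Data.Integer.Base as ℤ
import Data.Integer.Tactic.RingSolver as ℤ-Solver
open import Data.List.Base using (List; []; _∷_; length; filter; tabulate)
import Data.List.Membership.DecPropositional as DecMembership
open import Data.List.Relation.Unary.All as All using (All; []; _∷_)
open import Data.List.Relation.Unary.AllPairs using ([]; _∷_)
open import Data.List.Relation.Unary.Any using (here; there)
open import Data.List.Relation.Unary.Unique.Propositional using (Unique)
open import Data.Nat.Base using (ℕ; zero; suc; _+_; _*_; _≤_; z≤n; s≤s)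
import Data.Nat.Properties as ℕ
import Data.Nat.Tactic.RingSolver as ℕ-Solver
open import Data.Product.Base using (Σ; ∃; _×_; _,_; proj₁; proj₂)
open import Data.Rational.Unnormalised.Base using (*≡*)
open import Data.Sum.Base as Sum using (_⊎_; inj₁; inj₂)
open import Data.Sum.Function.Propositional using (_⊎-↔_)
import Data.Vec.Base as Vec
open import Data.Vec.Properties using (lookup∘tabulate; lookup⇒[]=; []=⇒lookup)
open import Function.Base using (_∘_; id)
open import Function.Bundles using (_↔_; Inverse; mk↔ₛ′)
open import Function.Properties.Inverse using (↔-trans; ↔-sym; ↔-refl)
open import Function.Related.TypeIsomorphisms using (⊎-assoc)
open import Level using (0ℓ)
open import Relation.Binary.Construct.Closure.ReflexiveTransitive using (Star; ε; _◅_; _◅◅_; reverse)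
open import Relation.Binary.PropositionalEquality
open import Relation.Nullary using (¬_; Dec; yes; no; does; contradiction)
open import Relation.Nullary.Decidable using (¬?; _×-dec_; dec-true; dec-false; toSum)
open import Relation.Unary using (Pred; Decidable)

private variable
  n m n′ m′ : ℕ

-- Paths and cuts in trees

module Incidence (G : Graph n m) where

  joins-ends : ∀ e → Joins G e (proj₁ (ends G e)) (proj₂ (ends G e))
  joins-ends e = inj₁ refl

  joins-sym : ∀ {e u v} → Joins G e u v → Joins G e v u
  joins-sym = Sum.swap

  joins⇒incidentˡ : ∀ {e u v} → Joins G e u v → Incident G u e
  joins⇒incidentˡ (inj₁ p) = inj₁ (sym (cong proj₁ p))
  joins⇒incidentˡ (inj₂ p) = inj₂ (sym (cong proj₂ p))

  joins⇒incidentʳ : ∀ {e u v} → Joins G e u v → Incident G v e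
  joins⇒incidentʳ = joins⇒incidentˡ ∘ joins-sym

  incident⇒joins : ∀ {e u} → Incident G u e → ∃ (Joins G e u)
  incident⇒joins (inj₁ refl) = _ , inj₁ refl
  incident⇒joins (inj₂ refl) = _ , inj₂ refl

  incident⇒endpoint : ∀ {e u v w} → Joins G e u v → Incident G w e → w ≡ u ⊎ w ≡ v
  incident⇒endpoint (inj₁ p) (inj₁ q) = inj₁ (trans q (cong proj₁ p))
  incident⇒endpoint (inj₁ p) (inj₂ q) = inj₂ (trans q (cong proj₂ p))
  incident⇒endpoint (inj₂ p) (inj₁ q) = inj₂ (trans q (cong proj₁ p))
  incident⇒endpoint (inj₂ p) (inj₂ q) = inj₁ (trans q (cong proj₂ p))

  joins⇒≢ : ∀ {e u v} → Joins G e u v → u ≢ v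
  joins⇒≢ {e} (inj₁ p) refl = loopless G e (trans (cong proj₁ p) (sym (cong proj₂ p)))
  joins⇒≢ {e} (inj₂ p) refl = loopless G e (trans (cong proj₁ p) (sym (cong proj₂ p)))

  joins-functional : ∀ {e u v w} → Joins G e u v → Joins G e u w → v ≡ w
  joins-functional j k with incident⇒endpoint k (joins⇒incidentʳ j)
  ... | inj₁ v≡u = contradiction (sym v≡u) (joins⇒≢ j)
  ... | inj₂ v≡w = v≡w

  -- The order in which `ends` stores an edge is arbitrary, so only a symmetric relation passes from
  -- a `Joins` witness to the stored pair.
  symmetric-on-ends : ∀ {e u v} (R : Fin n → Fin n → Set) → (∀ {x y} → R x y → R y x) →
                      Joins G e u v → R u v → R (proj₁ (ends G e)) (proj₂ (ends G e))
  symmetric-on-ends R s (inj₁ p) r = subst (λ (x , y) → R x y) (sym p) r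
  symmetric-on-ends R s (inj₂ p) r = subst (λ (x , y) → R x y) (sym p) (s r)

  infixr 5 _++ʷ_

  _++ʷ_ : ∀ {u v w} → Walk G u v → Walk G v w → Walk G u w
  nil        ++ʷ q = q
  cons e j p ++ʷ q = cons e j (p ++ʷ q)

  vertices : ∀ {u v} → Walk G u v → List (Fin n)
  vertices (nil {u})        = u ∷ []
  vertices (cons {u} _ _ w) = u ∷ vertices w

module Avoiding (G : Graph n m) where

  open Incidence G

  Step≢ : Fin m → Fin n → Fin n → Set
  Step≢ e u v = ∃ λ f → e ≢ f × Joins G f u v

  -- Connectivity in G - e, expressed inside G so that edges keep their numbers.
  ReachableWithout : Fin m → Fin n → Fin n → Set
  ReachableWithout e = Star (Step≢ e)

  step≢-sym : ∀ {e u v} → Step≢ e u v → Step≢ e v u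
  step≢-sym (f , e≢f , j) = f , e≢f , joins-sym j

  reachable-sym : ∀ {e u v} → ReachableWithout e u v → ReachableWithout e v u
  reachable-sym = reverse step≢-sym

  module _ {P : Fin n → Set} where

    all-sources : ∀ {u v} (w : Walk G u v) → All P (vertices w) → All P (sources w)
    all-sources nil          _        = []
    all-sources (cons _ _ w) (p ∷ ps) = p ∷ all-sources w ps

    at-start : ∀ {u v} (w : Walk G u v) → All P (vertices w) → P u
    at-start nil          (p ∷ _) = p
    at-start (cons _ _ w) (p ∷ _) = p

    at-end : ∀ {u v} (w : Walk G u v) → All P (vertices w) → P v
    at-end nil          (p ∷ _)  = p
    at-end (cons _ _ w) (_ ∷ ps) = at-end w ps

  -- When a path is closed to a cycle by an edge preceding it, the cycle starts at the path's final
  -- vertex. This is the vertex list of that cycle.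
  sources-unique : ∀ {u v} (w : Walk G u v) → Unique (vertices w) → Unique (v ∷ sources w)
  sources-unique nil          _        = [] ∷ []
  sources-unique (cons _ _ w) (a ∷ as) with sources-unique w as
  ... | b ∷ bs = (at-end w a ∘ sym ∷ b) ∷ all-sources w a ∷ bs

  missed-edges : ∀ {x u v} (w : Walk G u v) → All (x ≢_) (vertices w) →
                 All (λ f → ¬ Incident G x f) (edges w)
  missed-edges nil          _        = []
  missed-edges (cons e j w) (p ∷ ps) = off ∷ missed-edges w ps
    where
    off : ¬ Incident G _ e
    off i with incident⇒endpoint j i
    ... | inj₁ x≡u = p x≡u
    ... | inj₂ x≡v = at-start w ps x≡v

  -- The first edge of a path touches its start vertex, which no later edge touches.
  edges-unique : ∀ {u v} (w : Walk G u v) → Unique (vertices w) → Unique (edges w)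
  edges-unique nil          _        = []
  edges-unique (cons e j w) (a ∷ as) =
    All.map (λ ¬i e≡f → ¬i (subst (Incident G _) e≡f (joins⇒incidentˡ j))) (missed-edges w a)
    ∷ edges-unique w as

  PathWithout : Fin m → Fin n → Fin n → Set
  PathWithout e u v = Σ (Walk G u v) λ w → Unique (vertices w) × All (e ≢_) (edges w)

  open DecMembership (_≟_ {n}) using () renaming (_∈_ to _∈ˡ_; _∈?_ to _∈ˡ?_)

  path-suffix : ∀ {e u v x} ((w , _) : PathWithout e u v) → x ∈ˡ vertices w → PathWithout e x v
  path-suffix (nil , us , es) (here refl) = nil , us , es
  path-suffix (cons f j w , us , es) (here refl) = cons f j w , us , es
  path-suffix (cons f j w , (_ ∷ us) , (_ ∷ es)) (there x∈) = path-suffix (w , us , es) x∈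

  -- Loop erasure: if the new first vertex already occurs on the path built so far, only the suffix
  -- from that occurrence is kept.
  path : ∀ {e u v} → ReachableWithout e u v → PathWithout e u v
  path ε = nil , ([] ∷ []) , []
  path (_◅_ {u} (f , e≢f , j) s) with path s
  ... | p@(w , us , es) with u ∈ˡ? vertices w
  ...   | yes u∈ = path-suffix p u∈
  ...   | no  u∉ = cons f j w , (All.tabulate (λ y∈ u≡y → u∉ (subst (_∈ˡ _) (sym u≡y) y∈)) ∷ us) , (e≢f ∷ es)

  -- A path from `v` back to `u` that avoids `e` would close up with `e` to a cycle.
  bridge : Acyclic G → ∀ {e u v} → Joins G e u v → ¬ ReachableWithout e u v
  bridge acyclic {e} j s with path (reachable-sym s)
  ... | w , us , es = acyclic (cons e j w) record
    { nonempty         = s≤s z≤n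
    ; distinctEdges    = es ∷ edges-unique w us
    ; distinctVertices = sources-unique w us
    }

module Cuts (T : Graph n m) (isTree : IsTree T) where

  open Incidence T
  open Avoiding T

  private
    connected = proj₁ isTree
    tail head : Fin m → Fin n
    tail e = proj₁ (ends T e)
    head e = proj₂ (ends T e)

  -- Follow the walk up to its first use of `e`. If there is one, an end of `e` has been reached
  -- without `e`.
  cut : ∀ e {u v} → Walk T u v →
        ReachableWithout e u v ⊎ ReachableWithout e u (tail e) ⊎ ReachableWithout e u (head e)
  cut e nil = inj₁ ε
  cut e (cons f j w) with e ≟ f
  ... | yes refl with incident⇒endpoint (joins-ends e) (joins⇒incidentˡ j)
  ...   | inj₁ refl = inj₂ (inj₁ ε)
  ...   | inj₂ refl = inj₂ (inj₂ ε)
  cut e (cons f j w) | no e≢f = Sum.map s (Sum.map s s) (cut e w)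
    where
    s : ∀ {x} → ReachableWithout e _ x → ReachableWithout e _ x
    s = (f , e≢f , j) ◅_

  reaches-end : ∀ e v → ReachableWithout e v (tail e) ⊎ ReachableWithout e v (head e)
  reaches-end e v with cut e (connected v (tail e))
  ... | inj₁ s = inj₁ s
  ... | inj₂ s = s

  -- The value is read off from one chosen walk; `reachable⇒side≡` and `side≡⇒reachable` show that
  -- it names the component of T - e containing the vertex.
  side : Fin m → Fin n → Bool
  side e v = Sum.[ (λ _ → false) , (λ _ → true) ] (reaches-end e v)

  reachable⇒side≡ : ∀ {e u v} → ReachableWithout e u v → side e u ≡ side e v
  reachable⇒side≡ {e} {u} {v} s with reaches-end e u | reaches-end e v
  ... | inj₁ _ | inj₁ _ = refl
  ... | inj₂ _ | inj₂ _ = refl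
  ... | inj₁ p | inj₂ q = ⊥-elim (bridge (proj₂ isTree) (joins-ends e) (reachable-sym p ◅◅ s ◅◅ q))
  ... | inj₂ p | inj₁ q = ⊥-elim (bridge (proj₂ isTree) (joins-ends e) (reachable-sym q ◅◅ reachable-sym s ◅◅ p))

  side≡⇒reachable : ∀ {e u v} → side e u ≡ side e v → ReachableWithout e u v
  side≡⇒reachable {e} {u} {v} eq with reaches-end e u | reaches-end e v
  ... | inj₁ p | inj₁ q = p ◅◅ reachable-sym q
  ... | inj₂ p | inj₂ q = p ◅◅ reachable-sym q

  side-same : ∀ {e f u v} → e ≢ f → Joins T f u v → side e u ≡ side e v
  side-same e≢f j = reachable⇒side≡ ((_ , e≢f , j) ◅ ε)

  side-differs : ∀ {e u v} → Joins T e u v → side e u ≢ side e v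
  side-differs j eq = bridge (proj₂ isTree) j (side≡⇒reachable eq)

  -- Rooted trees: parents, descents and the number of edges.

  module Rooted (r : Fin n) where

    -- The parent relation: of the two ends of `e`, the parent is the one on the root's side of `e`.
    Down : Fin m → Fin n → Fin n → Set
    Down e p v = Joins T e p v × side e p ≡ side e r

    down⇒side≢ : ∀ {e p v} → Down e p v → side e v ≢ side e r
    down⇒side≢ (j , eq) eq′ = side-differs j (trans eq (sym eq′))

    root-not-child : ∀ {e p} → ¬ Down e p r
    root-not-child d = down⇒side≢ d refl

    orient : ∀ {e u v} → Joins T e u v → Down e u v ⊎ Down e v u
    orient {e} {u} {v} j with side e u ≟ᵇ side e r | side e v ≟ᵇ side e r
    ... | yes p | _     = inj₁ (j , p)
    ... | no _  | yes q = inj₂ (joins-sym j , q)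
    ... | no ¬p | no ¬q = ⊥-elim (side-differs j (trans (¬-not ¬p) (sym (¬-not ¬q))))

    orient-incident : ∀ {e v} → Incident T v e → ∃ (Down e v) ⊎ ∃ (λ p → Down e p v)
    orient-incident i with incident⇒joins i
    ... | w , j = Sum.map (w ,_) (w ,_) (orient j)

    -- A walk that changes the side of `f` must traverse `f` and hence visit `v`, while avoiding `e`
    -- keeps it on one side of `e`.
    crossing : ∀ {e f q v x y} → e ≢ f → Joins T f q v → ReachableWithout e x y →
               side f x ≢ side f y → side e x ≡ side e v
    crossing e≢f j ε ≢ = contradiction refl ≢
    crossing {f = f} e≢f j ((g , e≢g , k) ◅ s) ≢ with f ≟ g
    ... | no f≢g = trans (side-same e≢g k) (crossing e≢f j s (λ eq → ≢ (trans (side-same f≢g k) eq)))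
    ... | yes refl with incident⇒endpoint j (joins⇒incidentˡ k)
    ...   | inj₁ refl = side-same e≢f j
    ...   | inj₂ refl = refl

    -- If `e` and `f` differ, then `p` lies beyond `f` together with `v`, since `e` joins them. A
    -- walk from `r` to `p` without `e` therefore crosses `f`, and by `crossing` the vertex `v`
    -- would be on the root's side of `e`.
    parent-edge-unique : ∀ {e f p q v} → Down e p v → Down f q v → e ≡ f
    parent-edge-unique {e} {f} d@(j , eq) d′@(k , eq′) with e ≟ f
    ... | yes e≡f = e≡f
    ... | no  e≢f = ⊥-elim (down⇒side≢ d (sym (crossing e≢f k (side≡⇒reachable (sym eq)) r≢p)))
      where
      r≢p : side f r ≢ side f _
      r≢p r≡p = down⇒side≢ d′ (sym (trans r≡p (side-same (e≢f ∘ sym) j)))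

    parent-unique : ∀ {e p q v} → Down e p v → Down e q v → p ≡ q
    parent-unique (j , _) (k , _) = joins-functional (joins-sym j) (joins-sym k)

    -- The path from the root, as an inductive family: it carries the recursion by which the greedy
    -- matching is defined.
    data Descendant : Fin n → Set where
      root  : Descendant r
      child : ∀ {e p v} → Down e p v → Descendant p → Descendant v

    descend : ∀ {u v} → Walk T u v → Descendant u → Descendant v
    descend nil          d = d
    descend (cons e j w) d with orient j
    ... | inj₁ down = descend w (child down d)
    descend (cons e j w) root           | inj₂ up = ⊥-elim (root-not-child up)
    -- An upward step leads back to the parent recorded last, because parent edges are unique; the
    -- last `child` is dropped.
    descend (cons e j w) (child down d) | inj₂ up with parent-edge-unique down up
    ... | refl with parent-unique down up
    ...   | refl = descend w d

    descendant : ∀ v → Descendant v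
    descendant v = descend (connected r v) root

    parent : ∀ v → v ≢ r → ∃ λ e → ∃ λ p → Down e p v
    parent v v≢r with descendant v
    ... | root      = contradiction refl v≢r
    ... | child d _ = _ , _ , d

    lower : ∀ e → ∃ λ p → ∃ λ v → Down e p v
    lower e with orient (joins-ends e)
    ... | inj₁ d = _ , _ , d
    ... | inj₂ d = _ , _ , d

    child-unique : ∀ {e p q v w} → Down e p v → Down e q w → v ≡ w
    child-unique (j , eq) (k , eq′) with incident⇒endpoint k (joins⇒incidentʳ j)
    ... | inj₁ refl = ⊥-elim (side-differs j (trans eq (sym eq′)))
    ... | inj₂ v≡w  = v≡w

    vertex : Fin (suc m) → Fin n
    vertex zero    = r
    vertex (suc e) = proj₁ (proj₂ (lower e))

    vertex-injective : ∀ {x y} → vertex x ≡ vertex y → x ≡ y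
    vertex-injective {zero}  {zero}  _  = refl
    vertex-injective {zero}  {suc f} eq = ⊥-elim (root-not-child (subst (Down f _) (sym eq) (proj₂ (proj₂ (lower f)))))
    vertex-injective {suc e} {zero}  eq = ⊥-elim (root-not-child (subst (Down e _) eq (proj₂ (proj₂ (lower e)))))
    vertex-injective {suc e} {suc f} eq =
      cong suc (parent-edge-unique (proj₂ (proj₂ (lower e))) (subst (Down f _) (sym eq) (proj₂ (proj₂ (lower f)))))

    index : Fin n → Fin (suc m)
    index v with v ≟ r
    ... | yes _   = zero
    ... | no  v≢r = suc (proj₁ (parent v v≢r))

    index-injective : ∀ {u v} → index u ≡ index v → u ≡ v
    index-injective {u} {v} eq with u ≟ r | v ≟ r
    ... | yes u≡r | yes v≡r = trans u≡r (sym v≡r)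
    ... | no u≢r  | no v≢r  =
      child-unique (proj₂ (proj₂ (parent u u≢r)))
        (subst (λ e → Down e (proj₁ (proj₂ (parent v v≢r))) v) (sym (suc-injective eq)) (proj₂ (proj₂ (parent v v≢r))))

    -- There are injections both ways: the root together with the lower ends of the edges, and each
    -- vertex other than the root with its parent edge.
    size : suc m ≡ n
    size = ℕ.≤-antisym (injective⇒≤ vertex-injective) (injective⇒≤ index-injective)

-- Finite sums and degrees

-- Stated over any commutative monoid in order to serve both for counting in ℕ and for parities in
-- 𝔽₂.
module Summation {c ℓ} (M : CommutativeMonoid c ℓ) where

  open CommutativeMonoid M renaming (trans to ≈-trans; sym to ≈-sym; ε to 0#) hiding (refl)
  open MonoidSum M public

  sum-single : ∀ {n} (t : Fin n → Carrier) j → (∀ i → i ≢ j → t i ≈ 0#) → sum t ≈ t j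
  sum-single {suc n} t j vanish = ≈-trans (sum-remove {i = j} t)
    (≈-trans (∙-congˡ (≈-trans (sum-cong-≋ (λ i → vanish _ (punchInᵢ≢i j i))) (sum-replicate-zero n)))
           (identityʳ (t j)))

  sum-splitAt : ∀ a {b} (h : Fin a ⊎ Fin b → Carrier) →
                sum (h ∘ splitAt a) ≈ sum (h ∘ inj₁) ∙ sum (h ∘ inj₂)
  sum-splitAt zero    h = ≈-sym (identityˡ _)
  sum-splitAt (suc a) h =
    ≈-trans (∙-congˡ (sum-splitAt a (h ∘ Sum.map₁ suc))) (≈-sym (assoc _ _ _))

  sum-⊎ : ∀ {a b k} (π : (Fin a ⊎ Fin b) ↔ Fin k) (g : Fin k → Carrier) →
          sum g ≈ sum (g ∘ Inverse.to π ∘ inj₁) ∙ sum (g ∘ Inverse.to π ∘ inj₂)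
  sum-⊎ {a} π g = ≈-trans (sum-permute g (↔-trans (+↔⊎ {a}) π)) (sum-splitAt a (g ∘ Inverse.to π))

-- Perfect matchings, edge deletion and parity across cuts.

does⇒ : {P : Set} (P? : Dec P) → does P? ≡ true → P
does⇒ (yes p) _ = p

not-does⇒ : {P : Set} (P? : Dec P) → not (does P?) ≡ true → ¬ P
not-does⇒ (no ¬p) _ = ¬p

-- Matchings are Boolean functions here, so that they can be composed with edge bijections and occur
-- as coefficients in sums over 𝔽₂.
Perfect : Graph n m → (Fin m → Bool) → Set
Perfect G M = ∀ v → ∃ λ e → (M e ≡ true × Incident G v e) × (∀ {f} → M f ≡ true × Incident G v f → e ≡ f)

perfect⇒isPerfectMatching : (G : Graph n m) {M : Fin m → Bool} → Perfect G M → IsPerfectMatching G (Vec.tabulate M)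
perfect⇒isPerfectMatching G {M} perfect v with perfect v
... | e , (Me , i) , unique =
  e , (lookup⇒[]= e _ (trans (lookup∘tabulate M e) Me) , i) ,
  λ {f} (f∈ , j) → unique (trans (sym (lookup∘tabulate M f)) ([]=⇒lookup f∈) , j)

-- Deletion leaves the vertices alone, so a perfect matching of G - g through `f`, carried along
-- `punchIn g`, is a perfect matching of G that avoids `g`.
delete-covered : (G : Graph n m) (g : Fin m) → MatchingCovered (delete G g) → ∀ f → f ≢ g →
                 ∃ λ M → Perfect G M × M g ≡ false × M f ≡ true
delete-covered {m = suc m} G g covered f f≢g with MatchingCovered.covered covered (punchOut (f≢g ∘ sym))
... | N , isPerfect , f∈N =
  M , perfect , dec-false (lift? g) (λ (e , eq , _) → punchInᵢ≢i g e eq) ,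
  dec-true (lift? f) (_ , punchIn-punchOut (f≢g ∘ sym) , f∈N)
  where
  lift? : ∀ h → Dec (∃ λ e → punchIn g e ≡ h × e ∈ N)
  lift? h = any? (λ e → (punchIn g e ≟ h) ×-dec (e ∈? N))
  M : Fin (suc m) → Bool
  M h = does (lift? h)
  perfect : Perfect G M
  perfect v with isPerfect v
  ... | e , (e∈N , i) , unique = punchIn g e , (dec-true (lift? _) (e , refl , e∈N) , i) , unique′
    where
    unique′ : ∀ {h} → M h ≡ true × Incident G v h → punchIn g e ≡ h
    unique′ {h} (Mh , j) with does⇒ (lift? h) Mh
    ... | _ , refl , h∈N = cong (punchIn g) (unique (h∈N , j))

module 𝔽₂ where
  open Summation (CommutativeRing.+-commutativeMonoid xor-∧-commutativeRing) public
  open SemiringSum (CommutativeRing.semiring xor-∧-commutativeRing) public using (*-distribˡ-sum)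

-- Over 𝔽₂, the number of vertices on one side of a cut and the number of
-- matching edges across the cut coincide.
single-crossing-edge : (G : Graph n m) {M : Fin m → Bool} → Perfect G M →
  (s : Fin n → Bool) (h : Fin m) → M h ≡ true →
  (∀ f → f ≢ h → M f ≡ true → s (proj₁ (ends G f)) ≡ s (proj₂ (ends G f))) →
  𝔽₂.sum s ≡ s (proj₁ (ends G h)) xor s (proj₂ (ends G h))
single-crossing-edge {n} {m} G {M} perfect s h Mh within = begin
  sum s                                               ≡⟨ sum-cong-≗ covered-once ⟩
  sum (λ v → s v ∧ sum (λ f → M f ∧ I v f))           ≡⟨ sum-cong-≗ (λ v → *-distribˡ-sum (s v) (λ f → M f ∧ I v f)) ⟩
  sum (λ v → sum (λ f → s v ∧ (M f ∧ I v f)))         ≡⟨ ∑-comm (λ v f → s v ∧ (M f ∧ I v f)) ⟩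
  -- Grouped by edges, a matching edge contributes the sum of `s` over its two ends, which is zero
  -- unless it crosses the cut.
  sum (λ f → sum (λ v → s v ∧ (M f ∧ I v f)))         ≡⟨ sum-cong-≗ across ⟩
  sum (λ f → M f ∧ δ f)                               ≡⟨ sum-single _ h vanishes ⟩
  M h ∧ δ h                                           ≡⟨ cong (_∧ δ h) Mh ⟩
  δ h                                                 ∎
  where
  open 𝔽₂ hiding (sum-⊎)
  open ≡-Reasoning
  I : Fin n → Fin m → Bool
  I v f = does (incident? G v f)
  δ : Fin m → Bool
  δ f = s (proj₁ (ends G f)) xor s (proj₂ (ends G f))

  covered-once : ∀ v → s v ≡ s v ∧ sum (λ f → M f ∧ I v f)
  covered-once v with perfect v
  ... | e , (Me , i) , unique = sym (trans (cong (s v ∧_) one) (∧-identityʳ (s v)))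
    where
    others : ∀ f → f ≢ e → M f ∧ I v f ≡ false
    others f f≢e with M f in Mf
    ... | false = refl
    ... | true  = dec-false (incident? G v f) (λ j → f≢e (sym (unique (Mf , j))))
    one : sum (λ f → M f ∧ I v f) ≡ true
    one = trans (sum-single _ e others) (cong₂ _∧_ Me (dec-true (incident? G v e) i))

  at : ∀ x → sum (λ v → s v ∧ does (v ≟ x)) ≡ s x
  at x = trans
    (sum-single _ x (λ v v≢x → trans (cong (s v ∧_) (dec-false (v ≟ x) v≢x)) (∧-zeroʳ (s v))))
    (trans (cong (s x ∧_) (dec-true (x ≟ x) refl)) (∧-identityʳ (s x)))

  -- The exclusive or would cancel at a loop; looplessness keeps the two ends apart.
  two-ends : ∀ v f → I v f ≡ does (v ≟ proj₁ (ends G f)) xor does (v ≟ proj₂ (ends G f))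
  two-ends v f with v ≟ proj₁ (ends G f) | v ≟ proj₂ (ends G f)
  ... | yes p | yes q = contradiction (trans (sym p) q) (loopless G f)
  ... | yes p | no _  = refl
  ... | no _  | _     = refl

  across : ∀ f → sum (λ v → s v ∧ (M f ∧ I v f)) ≡ M f ∧ δ f
  across f with M f
  ... | false = trans (sum-cong-≗ (λ v → ∧-zeroʳ (s v))) (sum-replicate-zero n)
  ... | true  = begin
    sum (λ v → s v ∧ I v f)
      ≡⟨ sum-cong-≗ (λ v → trans (cong (s v ∧_) (two-ends v f)) (∧-distribˡ-xor (s v) _ _)) ⟩
    sum (λ v → (s v ∧ does (v ≟ x)) xor (s v ∧ does (v ≟ y)))
      ≡⟨ ∑-distrib-+ (λ v → s v ∧ does (v ≟ x)) (λ v → s v ∧ does (v ≟ y)) ⟩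
    sum (λ v → s v ∧ does (v ≟ x)) xor sum (λ v → s v ∧ does (v ≟ y))
      ≡⟨ cong₂ _xor_ (at x) (at y) ⟩
    δ f ∎
    where
    x = proj₁ (ends G f)
    y = proj₂ (ends G f)

  vanishes : ∀ f → f ≢ h → M f ∧ δ f ≡ false
  vanishes f f≢h with M f in Mf
  ... | false = refl
  ... | true  = trans (cong (s (proj₁ (ends G f)) xor_) (sym (within f f≢h Mf))) (xor-same (s (proj₁ (ends G f))))

-- Counting in ℕ: indicators, degrees and leaves.

open Summation ℕ.+-0-commutativeMonoid

module _ {P : Set} where

  ind : Dec P → ℕ
  ind P? = if does P? then 1 else 0

  ind-yes : (P? : Dec P) → P → ind P? ≡ 1
  ind-yes (yes _) _ = refl
  ind-yes (no ¬p) p = contradiction p ¬p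

  ind-no : (P? : Dec P) → ¬ P → ind P? ≡ 0
  ind-no (yes p) ¬p = contradiction p ¬p
  ind-no (no _)  _  = refl

ind-cong : {P Q : Set} (P? : Dec P) (Q? : Dec Q) → (P → Q) → (Q → P) → ind P? ≡ ind Q?
ind-cong (yes p) Q? f g = sym (ind-yes Q? (f p))
ind-cong (no ¬p) Q? f g = sym (ind-no Q? (¬p ∘ g))

ind-⊎ : {P Q R : Set} (R? : Dec R) (P? : Dec P) (Q? : Dec Q) →
        (R → P ⊎ Q) → (P → R) → (Q → R) → ¬ (P × Q) → ind R? ≡ ind P? + ind Q?
ind-⊎ R? (yes p) (yes q) f g h x = contradiction (p , q) x
ind-⊎ R? (yes p) (no ¬q) f g h x = ind-yes R? (g p)
ind-⊎ R? (no ¬p) (yes q) f g h x = ind-yes R? (h q)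
ind-⊎ R? (no ¬p) (no ¬q) f g h x = ind-no R? (Sum.[ ¬p , ¬q ] ∘ f)

count≡sum : {P : Pred (Fin n) 0ℓ} (P? : Decidable P) → count P? ≡ sum (ind ∘ P?)
count≡sum {n} P? = go {n} id
  where
  go : ∀ {k} (f : Fin k → Fin n) → length (filter P? (tabulate f)) ≡ sum (λ i → ind (P? (f i)))
  go {zero}  f = refl
  go {suc k} f with P? (f zero)
  ... | yes _ = cong suc (go (f ∘ suc))
  ... | no _  = go (f ∘ suc)

sum-const : ∀ n c → sum {n} (λ _ → c) ≡ n * c
sum-const zero    c = refl
sum-const (suc n) c = cong (c +_) (sum-const n c)

sum-mono : ∀ {n} {f g : Fin n → ℕ} → (∀ i → f i ≤ g i) → sum f ≤ sum g
sum-mono {zero}  f≤g = z≤n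
sum-mono {suc n} f≤g = ℕ.+-mono-≤ (f≤g zero) (sum-mono (f≤g ∘ suc))

term≤sum : ∀ {n} (f : Fin n → ℕ) i → f i ≤ sum f
term≤sum f zero    = ℕ.m≤m+n _ _
term≤sum f (suc i) = ℕ.≤-trans (term≤sum (f ∘ suc) i) (ℕ.m≤n+m _ _)

sum-ind-≡ : ∀ {n} (j : Fin n) → sum (λ i → ind (i ≟ j)) ≡ 1
sum-ind-≡ j = trans (sum-single _ j (λ i i≢j → ind-no (i ≟ j) i≢j)) (ind-yes (j ≟ j) refl)

-- Irrelevance ensures that an index is counted once rather than once per proof. For leaves this
-- makes the number of rungs equal to the number of leaves.
enumerate : ∀ {n} {P : Pred (Fin n) 0ℓ} (P? : Decidable P) → (∀ {i} (p q : P i) → p ≡ q) →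
            Fin (sum (ind ∘ P?)) ↔ Σ (Fin n) P
enumerate {zero} P? irr = mk↔ₛ′ (λ ()) (λ ()) (λ ()) (λ ())
enumerate {suc n} {P} P? irr with P? zero | enumerate (P? ∘ suc) irr
... | yes p | rest = mk↔ₛ′ to from to∘from from∘to
  where
  open Inverse rest renaming (to to to′; from to from′; strictlyInverseˡ to invˡ; strictlyInverseʳ to invʳ)
  to : Fin (suc _) → Σ (Fin (suc n)) P
  to zero    = zero , p
  to (suc i) = suc (proj₁ (to′ i)) , proj₂ (to′ i)
  from : Σ (Fin (suc n)) P → Fin (suc _)
  from (zero  , _) = zero
  from (suc i , q) = suc (from′ (i , q))
  to∘from : ∀ x → to (from x) ≡ x
  to∘from (zero  , q) = cong (zero ,_) (irr p q)
  to∘from (suc i , q) = cong (λ (j , q′) → suc j , q′) (invˡ (i , q))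
  from∘to : ∀ x → from (to x) ≡ x
  from∘to zero    = refl
  from∘to (suc i) = cong suc (invʳ i)
... | no ¬p | rest = mk↔ₛ′ to from to∘from invʳ
  where
  open Inverse rest renaming (to to to′; from to from′; strictlyInverseˡ to invˡ; strictlyInverseʳ to invʳ)
  to : Fin _ → Σ (Fin (suc n)) P
  to i = suc (proj₁ (to′ i)) , proj₂ (to′ i)
  from : Σ (Fin (suc n)) P → Fin _
  from (zero  , q) = contradiction q ¬p
  from (suc i , q) = from′ (i , q)
  to∘from : ∀ x → to (from x) ≡ x
  to∘from (zero  , q) = contradiction q ¬p
  to∘from (suc i , q) = cong (λ (j , q′) → suc j , q′) (invˡ (i , q))

isLeaf? : (T : Graph n m) → Decidable (IsLeaf T)
isLeaf? T v = degree T v ℕ.≟ 1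

degree≡sum : (G : Graph n m) (v : Fin n) → degree G v ≡ sum (λ e → ind (incident? G v e))
degree≡sum G v = count≡sum (incident? G v)

-- Double counting of incidences; each edge has exactly two ends because it is not a loop.
handshake : (G : Graph n m) → sum (degree G) ≡ m * 2
handshake {n} {m} G = begin
  sum (degree G)                               ≡⟨ sum-cong-≗ (degree≡sum G) ⟩
  sum (λ v → sum (λ e → ind (incident? G v e)))  ≡⟨ ∑-comm (λ v e → ind (incident? G v e)) ⟩
  sum (λ e → sum (λ v → ind (incident? G v e)))  ≡⟨ sum-cong-≗ two ⟩
  sum {m} (λ _ → 2)                            ≡⟨ sum-const m 2 ⟩
  m * 2                                        ∎
  where
  open ≡-Reasoning
  two : ∀ e → sum (λ v → ind (incident? G v e)) ≡ 2
  two e = begin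
    sum (λ v → ind (incident? G v e))
      ≡⟨ sum-cong-≗ (λ v → ind-⊎ (incident? G v e) (v ≟ x) (v ≟ y) id inj₁ inj₂
                             (λ (p , q) → loopless G e (trans (sym p) q))) ⟩
    sum (λ v → ind (v ≟ x) + ind (v ≟ y))
      ≡⟨ ∑-distrib-+ (λ v → ind (v ≟ x)) (λ v → ind (v ≟ y)) ⟩
    sum (λ v → ind (v ≟ x)) + sum (λ v → ind (v ≟ y))
      ≡⟨ cong₂ _+_ (sum-ind-≡ x) (sum-ind-≡ y) ⟩
    2 ∎
    where
    x = proj₁ (ends G e)
    y = proj₂ (ends G e)

module _ (G : Graph n m) where

  -- Were `e` alone at `v`, the degree sum would collapse to its single term 1.
  another-edge : ∀ {v e} → ¬ IsLeaf G v → Incident G v e → ∃ λ f → f ≢ e × Incident G v f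
  another-edge {v} {e} ¬leaf i with any? (λ f → ¬? (f ≟ e) ×-dec incident? G v f)
  ... | yes found = found
  ... | no  ¬any  = contradiction (trans (degree≡sum G v) (trans only-e (ind-yes (incident? G v e) i))) ¬leaf
    where
    only-e : sum (λ f → ind (incident? G v f)) ≡ ind (incident? G v e)
    only-e = sum-single _ e (λ f f≢e → ind-no (incident? G v f) (λ j → ¬any (f , f≢e , j)))

  degree-positive : ∀ {v e} → Incident G v e → 1 ≤ degree G v
  degree-positive {v} {e} i = subst₂ _≤_ (ind-yes (incident? G v e) i) (sym (degree≡sum G v))
    (term≤sum (λ f → ind (incident? G v f)) e)

  -- Termwise, the incidence indicator at `v` dominates the indicators of `e` and `f`; if these
  -- differ, the degree is at least 2.
  leaf-edge-unique : ∀ {v e f} → IsLeaf G v → Incident G v e → Incident G v f → e ≡ f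
  leaf-edge-unique {v} {e} {f} leaf i j with e ≟ f
  ... | yes e≡f = e≡f
  ... | no  e≢f = contradiction
    (subst₂ _≤_ two (trans (sym (degree≡sum G v)) leaf) (sum-mono below)) λ { (s≤s ()) }
    where
    below : ∀ g → ind (g ≟ e) + ind (g ≟ f) ≤ ind (incident? G v g)
    below g with g ≟ e | g ≟ f
    ... | yes refl | yes refl = contradiction refl e≢f
    ... | yes refl | no _     = ℕ.≤-reflexive (sym (ind-yes (incident? G v g) i))
    ... | no _     | yes refl = ℕ.≤-reflexive (sym (ind-yes (incident? G v g) j))
    ... | no _     | no _     = z≤n
    two : sum (λ g → ind (g ≟ e) + ind (g ≟ f)) ≡ 2
    two = trans (∑-distrib-+ (λ g → ind (g ≟ e)) (λ g → ind (g ≟ f))) (cong₂ _+_ (sum-ind-≡ e) (sum-ind-≡ f))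

other-vertex : 2 ≤ n → ∀ (v : Fin n) → ∃ λ u → v ≢ u
other-vertex (s≤s (s≤s _)) zero    = suc zero , λ ()
other-vertex (s≤s (s≤s _)) (suc v) = zero , λ ()

incident-edge : (G : Graph n m) → Connected G → 2 ≤ n → ∀ v → ∃ (Incident G v)
incident-edge G connected 2≤n v with other-vertex 2≤n v
... | u , v≢u with connected v u
...   | nil        = contradiction refl v≢u
...   | cons e j _ = e , Incidence.joins⇒incidentˡ G j

-- Matchings of a tree

-- Leaves may stay uncovered, because in the doubled graph a rung can cover both copies of a leaf.
record NearPerfectMatching (T : Graph n m) (M : Fin m → Bool) : Set where
  field
    disjoint : ∀ {v e f} → M e ≡ true → M f ≡ true → Incident T v e → Incident T v f → e ≡ f
    covers   : ∀ v → ¬ IsLeaf T v → ∃ λ e → M e ≡ true × Incident T v e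

module TreeMatching (T : Graph n m) (isTree : IsTree T) where

  open Incidence T
  open Cuts T isTree

  -- The matching is chosen from the root downwards: a vertex that is not
  -- matched to its parent is matched along its preferred edge.
  module Greedy (r : Fin n) (preferred : Fin n → Fin m) (rootMatched : Bool) where

    open Rooted r

    -- Tells whether the vertex is matched to its parent. At the root, the value `true` feigns a
    -- matched parent edge and thereby leaves the root uncovered.
    matched↑ : ∀ {v} → Descendant v → Bool
    matched↑ root                = rootMatched
    matched↑ (child {e} {p} _ d) = does (e ≟ preferred p) ∧ not (matched↑ d)

    -- Parents and parent edges are unique, so all descents to a vertex take the same steps. This
    -- turns the recursion into the equations `up-root` and `up-child`.
    matched↑-irrelevant : ∀ {v} (d d′ : Descendant v) → matched↑ d ≡ matched↑ d′
    matched↑-irrelevant root        root         = refl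
    matched↑-irrelevant root        (child x _)  = ⊥-elim (root-not-child x)
    matched↑-irrelevant (child x _) root         = ⊥-elim (root-not-child x)
    matched↑-irrelevant (child x d) (child x′ d′) with parent-edge-unique x x′
    ... | refl with parent-unique x x′
    ...   | refl = cong (λ b → _ ∧ not b) (matched↑-irrelevant d d′)

    up : Fin n → Bool
    up v = matched↑ (descendant v)

    up-root : up r ≡ rootMatched
    up-root = matched↑-irrelevant (descendant r) root

    up-child : ∀ {e p v} → Down e p v → up v ≡ does (e ≟ preferred p) ∧ not (up p)
    up-child x = matched↑-irrelevant (descendant _) (child x (descendant _))

    M : Fin m → Bool
    M e = up (proj₁ (proj₂ (lower e)))

    M-child : ∀ {e p v} → Down e p v → M e ≡ up v
    M-child {e} x = cong up (child-unique (proj₂ (proj₂ (lower e))) x)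

    M-preferred : ∀ {v w} → Down (preferred v) v w → up v ≡ false → M (preferred v) ≡ true
    M-preferred {v} x eq with trans (M-child x) (up-child x)
    ... | eq′ with preferred v ≟ preferred v
    ...   | yes _ = trans eq′ (cong not eq)
    ...   | no ≢  = contradiction refl ≢

    M-parent : ∀ {e v w} → Down e v w → M e ≡ true → e ≡ preferred v × up v ≡ false
    M-parent {e} {v} x eq with trans (sym (up-child x)) (trans (sym (M-child x)) eq)
    ... | eq′ with e ≟ preferred v | up v
    ...   | yes e≡ | false = e≡ , refl

    -- A matching edge leading down from `v` is the preferred one and requires `v` not to be matched
    -- upwards; a matching edge leading up is the unique parent edge.
    disjoint : ∀ {v e f} → M e ≡ true → M f ≡ true → Incident T v e → Incident T v f → e ≡ f
    disjoint Me Mf i j with orient-incident i | orient-incident j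
    ... | inj₁ (_ , x) | inj₁ (_ , y) = trans (proj₁ (M-parent x Me)) (sym (proj₁ (M-parent y Mf)))
    ... | inj₁ (_ , x) | inj₂ (_ , y) = contradiction (trans (sym Mf) (trans (M-child y) (proj₂ (M-parent x Me)))) λ ()
    ... | inj₂ (_ , x) | inj₁ (_ , y) = contradiction (trans (sym Me) (trans (M-child x) (proj₂ (M-parent y Mf)))) λ ()
    ... | inj₂ (_ , x) | inj₂ (_ , y) = parent-edge-unique x y

    covers-preferring : ∀ {v w} → Down (preferred v) v w → up v ≡ false → ∃ λ e → M e ≡ true × Incident T v e
    covers-preferring x eq = _ , M-preferred x eq , joins⇒incidentˡ (proj₁ x)

    covers-child : ∀ {v w} → v ≢ r → Down (preferred v) v w → ∃ λ e → M e ≡ true × Incident T v e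
    covers-child {v} v≢r x with up v in eq
    ... | false = covers-preferring x eq
    ... | true with parent v v≢r
    ...   | e , p , y = e , trans (M-child y) eq , joins⇒incidentʳ (proj₁ y)

    root-uncovered : rootMatched ≡ true → ∀ {e} → Incident T r e → M e ≢ true
    root-uncovered eq i Me with orient-incident i
    ... | inj₁ (_ , x) = contradiction (trans (sym eq) (trans (sym up-root) (proj₂ (M-parent x Me)))) λ ()
    ... | inj₂ (_ , x) = root-not-child x

  module _ (r : Fin n) {e₀ : Fin m} (e₀-at-r : Incident T r e₀) where

    open Rooted r

    -- A non-leaf has an edge besides its parent edge, and that edge cannot lead up as well.
    downward-edge : ∀ v → v ≢ r → ¬ IsLeaf T v → ∃ λ e → ∃ (Down e v)
    downward-edge v v≢r ¬leaf with parent v v≢r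
    ... | e , p , x with another-edge T ¬leaf (joins⇒incidentʳ (proj₁ x))
    ...   | f , f≢e , i with orient-incident i
    ...     | inj₁ (w , y) = f , w , y
    ...     | inj₂ (_ , y) = contradiction (parent-edge-unique y x) f≢e

    preferred : Fin n → Fin m
    preferred v with v ≟ r | isLeaf? T v
    ... | yes _   | _        = e₀
    -- A leaf other than the root has no edge leading down; `e₀` is a mere default.
    ... | no _    | yes _    = e₀
    ... | no v≢r  | no ¬leaf = proj₁ (downward-edge v v≢r ¬leaf)

    preferred-root : preferred r ≡ e₀
    preferred-root with r ≟ r | isLeaf? T r
    ... | yes _  | _ = refl
    ... | no r≢r | _ = contradiction refl r≢r

    prefers-down : ∀ v → v ≡ r ⊎ ¬ IsLeaf T v → ∃ (Down (preferred v) v)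
    prefers-down v h with v ≟ r | isLeaf? T v
    ... | no v≢r   | yes leaf = ⊥-elim (Sum.[ v≢r , (λ ¬leaf → ¬leaf leaf) ] h)
    ... | no v≢r   | no ¬leaf = proj₂ (downward-edge v v≢r ¬leaf)
    ... | yes refl | _        with orient-incident e₀-at-r
    ...   | inj₁ down    = down
    ...   | inj₂ (_ , x) = ⊥-elim (root-not-child x)

    -- Declaring the root matched leaves it uncovered, which is permitted only if it is a leaf.
    rooted-matching : ∀ rootMatched → (¬ IsLeaf T r → rootMatched ≡ false) →
                      NearPerfectMatching T (Greedy.M r preferred rootMatched)
    rooted-matching rootMatched free = record { disjoint = disjoint ; covers = covers }
      where
      open Greedy r preferred rootMatched
      covers : ∀ v → ¬ IsLeaf T v → ∃ λ e → M e ≡ true × Incident T v e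
      covers v ¬leaf with v ≟ r
      ... | yes refl = covers-preferring (proj₂ (prefers-down v (inj₁ refl))) (trans up-root (free ¬leaf))
      ... | no v≢r   = covers-child v≢r (proj₂ (prefers-down v (inj₂ ¬leaf)))

    -- The root starts unmatched and prefers `e₀`, so the greedy choice takes `e₀` first.
    matching-through-root : ∃ λ M → NearPerfectMatching T M × M e₀ ≡ true
    matching-through-root = M , rooted-matching false (λ _ → refl) ,
      subst (λ f → M f ≡ true) preferred-root (M-preferred {v = r} (proj₂ (prefers-down r (inj₁ refl))) up-root)
      where open Greedy r preferred false

    matching-missing-root : IsLeaf T r → ∃ λ M → NearPerfectMatching T M × (∀ {f} → Incident T r f → M f ≢ true)
    matching-missing-root leaf =
      M , rooted-matching true (λ ¬leaf → contradiction leaf ¬leaf) , root-uncovered refl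
      where open Greedy r preferred true

  matching-through : ∀ e → ∃ λ M → NearPerfectMatching T M × M e ≡ true
  matching-through e = matching-through-root (proj₁ (ends T e)) (inj₁ refl)

  matching-missing : ∀ {v e} → IsLeaf T v → Incident T v e →
                     ∃ λ M → NearPerfectMatching T M × (∀ {f} → Incident T v f → M f ≢ true)
  matching-missing {v} leaf i = matching-missing-root v i leaf

-- Isomorphic leaf matchings

bool-× : {A : Set} → (A ⊎ A) ↔ (Bool × A)
bool-× = mk↔ₛ′ Sum.[ (false ,_) , (true ,_) ]
  (λ { (false , a) → inj₁ a ; (true , a) → inj₂ a })
  (λ { (false , a) → refl ; (true , a) → refl })
  (λ { (inj₁ a) → refl ; (inj₂ a) → refl })

-- An isomorphic leaf matching with the copy T′ identified with T, the Boolean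
-- telling the two copies apart.
record Doubling (T : Graph n m) (G : Graph n′ m′) : Set where
  field
    vertex : (Bool × Fin n) ↔ Fin n′
    edge   : ((Bool × Fin m) ⊎ Σ (Fin n) (IsLeaf T)) ↔ Fin m′

  V = Inverse.to vertex
  E = Inverse.to edge

  field
    joins-copy : ∀ b {e u v} → Joins T e u v → Joins G (E (inj₁ (b , e))) (V (b , u)) (V (b , v))
    joins-rung : ∀ {v} (leaf : IsLeaf T v) → Joins G (E (inj₂ (v , leaf))) (V (false , v)) (V (true , v))

doubling : {T : Graph n m} {G : Graph n′ m′} → IsomorphicLeafMatching T G → Doubling T G
doubling {n = n} {m = m} {T = T} matching = record
  { vertex     = ↔-trans (↔-sym bool-×) (↔-trans (↔-refl ⊎-↔ Copy.vertex) vertex)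
  ; edge       = ↔-trans (↔-sym bool-× ⊎-↔ ↔-refl) (↔-trans (⊎-assoc 0ℓ _ _ _)
                   (↔-trans (↔-refl ⊎-↔ (Copy.edge ⊎-↔ ↔-refl)) edge))
  ; joins-copy = λ { false j → joinsT j ; true j → joinsT′ (Copy.joins j) }
  ; joins-rung = joinsLeaves
  }
  where
  open IsomorphicLeafMatching matching
  module Copy = _≅_ copy

module Doubled {T : Graph n m} {G : Graph n′ m′} (D : Doubling T G) where

  open Doubling D
  open Inverse vertex using () renaming (from to V⁻¹; strictlyInverseˡ to V-V⁻¹; strictlyInverseʳ to V⁻¹-V)
  open Inverse edge using () renaming (from to E⁻¹; strictlyInverseˡ to E-E⁻¹; strictlyInverseʳ to E⁻¹-E)

  EdgeOf : Set
  EdgeOf = (Bool × Fin m) ⊎ Σ (Fin n) (IsLeaf T)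

  V-injective : ∀ {x y} → V x ≡ V y → x ≡ y
  V-injective {x} {y} eq = trans (sym (V⁻¹-V x)) (trans (cong V⁻¹ eq) (V⁻¹-V y))

  E-injective : ∀ {x y} → E x ≡ E y → x ≡ y
  E-injective {x} {y} eq = trans (sym (E⁻¹-E x)) (trans (cong E⁻¹ eq) (E⁻¹-E y))

  every-vertex : (P : Fin n′ → Set) → (∀ x → P (V x)) → ∀ v → P v
  every-vertex P p v = subst P (V-V⁻¹ v) (p (V⁻¹ v))

  every-edge : (P : Fin m′ → Set) → (∀ x → P (E x)) → ∀ e → P e
  every-edge P p e = subst P (E-E⁻¹ e) (p (E⁻¹ e))

  -- Incidence in G in terms of T. A rung meets both copies of its leaf, hence the copy index is
  -- ignored there.
  _at_ : EdgeOf → Bool × Fin n → Set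
  inj₁ (b′ , e) at (b , v) = b ≡ b′ × Incident T v e
  inj₂ (w , _)  at (b , v) = v ≡ w

  at⇒incident : ∀ x {y} → x at y → Incident G (V y) (E x)
  at⇒incident (inj₁ (b , e)) (refl , i) = Incidence.joins⇒incidentˡ G (joins-copy b (proj₂ (Incidence.incident⇒joins T i)))
  at⇒incident (inj₂ (v , leaf)) {false , _} refl = Incidence.joins⇒incidentˡ G (joins-rung leaf)
  at⇒incident (inj₂ (v , leaf)) {true  , _} refl = Incidence.joins⇒incidentʳ G (joins-rung leaf)

  incident⇒at : ∀ x {y} → Incident G (V y) (E x) → x at y
  incident⇒at (inj₁ (b , e)) i with Incidence.incident⇒endpoint G (joins-copy b (Incidence.joins-ends T e)) i
  ... | inj₁ eq with V-injective eq
  ...   | refl = refl , inj₁ refl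
  incident⇒at (inj₁ (b , e)) i | inj₂ eq with V-injective eq
  ...   | refl = refl , inj₂ refl
  incident⇒at (inj₂ (v , leaf)) i with Incidence.incident⇒endpoint G (joins-rung leaf) i
  ... | inj₁ eq = cong proj₂ (V-injective eq)
  ... | inj₂ eq = cong proj₂ (V-injective eq)

  leaf-irrelevant : ∀ {v} (p q : IsLeaf T v) → p ≡ q
  leaf-irrelevant = ℕ.≡-irrelevant

  perfect : (μ : EdgeOf → Bool) →
            (∀ y → ∃ λ x → (μ x ≡ true × x at y) × (∀ z → μ z ≡ true → z at y → x ≡ z)) →
            Perfect G (μ ∘ E⁻¹)
  perfect μ choose = every-vertex _ at-vertex
    where
    at-vertex : ∀ y → ∃ λ e → (μ (E⁻¹ e) ≡ true × Incident G (V y) e) ×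
                (∀ {f} → μ (E⁻¹ f) ≡ true × Incident G (V y) f → e ≡ f)
    at-vertex y with choose y
    ... | x , (μx , i) , unique =
      E x , (trans (cong μ (E⁻¹-E x)) μx , at⇒incident x i) , λ {f} (μf , j) →
        trans (cong E (unique (E⁻¹ f) μf (incident⇒at (E⁻¹ f) (subst (Incident G (V y)) (sym (E-E⁻¹ f)) j))))
              (E-E⁻¹ f)

  module _ {M : Fin m → Bool} (nearPerfect : NearPerfectMatching T M) where

    open NearPerfectMatching nearPerfect

    private
      covered? : ∀ v → Dec (∃ λ e → M e ≡ true × Incident T v e)
      covered? v = any? (λ e → (M e ≟ᵇ true) ×-dec incident? T v e)

    mirrored : EdgeOf → Bool
    mirrored (inj₁ (_ , e)) = M e
    mirrored (inj₂ (v , _)) = not (does (covered? v))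

    -- A covered vertex uses the same edge in either copy and excludes its rung. An uncovered vertex
    -- must be a leaf, and its rung covers both copies at once.
    mirrored-perfect : Perfect G (mirrored ∘ E⁻¹)
    mirrored-perfect = perfect mirrored choose
      where
      choose : ∀ y → ∃ λ x → (mirrored x ≡ true × x at y) × (∀ z → mirrored z ≡ true → z at y → x ≡ z)
      choose (b , v) with covered? v in eq
      ... | yes (e , Me , i) = inj₁ (b , e) , (Me , (refl , i)) , unique
        where
        unique : ∀ z → mirrored z ≡ true → z at (b , v) → inj₁ (b , e) ≡ z
        unique (inj₁ (_ , f)) Mf (refl , j) = cong (λ g → inj₁ (b , g)) (disjoint Me Mf i j)
        unique (inj₂ (w , _)) μw refl = contradiction (e , Me , i) (not-does⇒ (covered? v) μw)
      ... | no uncovered with isLeaf? T v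
      ...   | no ¬leaf = contradiction (covers v ¬leaf) uncovered
      ...   | yes leaf = inj₂ (v , leaf) , (cong (not ∘ does) eq , refl) , unique
        where
        unique : ∀ z → mirrored z ≡ true → z at (b , v) → inj₂ (v , leaf) ≡ z
        unique (inj₁ (_ , f)) Mf (_ , j)       = contradiction (f , Mf , j) uncovered
        unique (inj₂ (_ , leaf′)) _ refl = cong (λ l → inj₂ (v , l)) (leaf-irrelevant leaf leaf′)

    mirrored-rung : ∀ {v} (leaf : IsLeaf T v) → (∀ {e} → Incident T v e → M e ≢ true) → mirrored (inj₂ (v , leaf)) ≡ true
    mirrored-rung {v} leaf missed = cong not (dec-false (covered? v) (λ (e , Me , i) → missed i Me))

  leafCount : ℕ
  leafCount = sum (ind ∘ isLeaf? T)

  leaves : Fin leafCount ↔ Σ (Fin n) (IsLeaf T)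
  leaves = enumerate (isLeaf? T) leaf-irrelevant

  vertices↔ : (Fin n ⊎ Fin n) ↔ Fin n′
  vertices↔ = ↔-trans bool-× vertex

  edges↔ : ((Fin m ⊎ Fin m) ⊎ Fin leafCount) ↔ Fin m′
  edges↔ = ↔-trans (bool-× ⊎-↔ leaves) edge

  order : n′ ≡ n + n
  order = sym (↔⇒≡ (↔-trans +↔⊎ vertices↔))

  size : m′ ≡ (m + m) + leafCount
  size = sym (↔⇒≡ (↔-trans (+↔⊎ {m + m}) (↔-trans (+↔⊎ ⊎-↔ ↔-refl) edges↔)))

  sum-edges : (g : Fin m′ → ℕ) →
    sum g ≡ (sum (λ e → g (E (inj₁ (false , e)))) + sum (λ e → g (E (inj₁ (true , e)))))
            + sum (λ i → g (E (inj₂ (Inverse.to leaves i))))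
  sum-edges g = trans (sum-⊎ (↔-trans (+↔⊎ {m} ⊎-↔ ↔-refl) edges↔) g)
    (cong (_+ sum (λ i → g (E (inj₂ (Inverse.to leaves i)))))
          (sum-splitAt m (g ∘ Inverse.to edges↔ ∘ inj₁)))

  -- The own copy contributes the degree in T, the other copy nothing, and the rungs contribute one
  -- exactly at a leaf.
  degree-doubled : ∀ b v → degree G (V (b , v)) ≡ degree T v + ind (isLeaf? T v)
  degree-doubled b v = trans (degree≡sum G (V (b , v)))
    (trans (sum-edges _) (cong₂ _+_ copies rungs))
    where
    inc : ∀ x → ℕ
    inc x = ind (incident? G (V (b , v)) (E x))
    same : ∀ {c} → b ≡ c → sum (λ e → inc (inj₁ (c , e))) ≡ degree T v
    same {c} b≡c = trans
      (sum-cong-≗ (λ e → ind-cong (incident? G _ _) (incident? T v e)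
        (proj₂ ∘ incident⇒at (inj₁ (c , e))) (λ i → at⇒incident (inj₁ (c , e)) (b≡c , i))))
      (sym (degree≡sum T v))
    other : ∀ {c} → b ≢ c → sum (λ e → inc (inj₁ (c , e))) ≡ 0
    other {c} b≢c = trans
      (sum-cong-≗ (λ e → ind-no (incident? G _ _) (b≢c ∘ proj₁ ∘ incident⇒at (inj₁ (c , e)))))
      (sum-replicate-zero m)
    copies : sum (λ e → inc (inj₁ (false , e))) + sum (λ e → inc (inj₁ (true , e))) ≡ degree T v
    copies with b ≟ᵇ false
    ... | yes b≡false = trans (cong₂ _+_ (same b≡false) (other (λ b≡true → contradiction (trans (sym b≡false) b≡true) λ ()))) (ℕ.+-identityʳ _)
    ... | no b≢false  = cong₂ _+_ (other b≢false) (same (¬-not b≢false))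
    rungs : sum (λ i → inc (inj₂ (Inverse.to leaves i))) ≡ ind (isLeaf? T v)
    rungs = Sum.[ rungs-leaf , rungs-nonleaf ]′ (toSum (isLeaf? T v))
      where
      rungs-nonleaf : ¬ IsLeaf T v → sum (λ i → inc (inj₂ (Inverse.to leaves i))) ≡ ind (isLeaf? T v)
      rungs-nonleaf ¬leaf = trans
        (sum-cong-≗ (λ i → ind-no (incident? G _ _) λ j →
          ¬leaf (subst (IsLeaf T) (sym (incident⇒at (inj₂ (Inverse.to leaves i)) j)) (proj₂ (Inverse.to leaves i)))))
        (trans (sum-replicate-zero leafCount) (sym (ind-no (isLeaf? T v) ¬leaf)))
      rungs-leaf : IsLeaf T v → sum (λ i → inc (inj₂ (Inverse.to leaves i))) ≡ ind (isLeaf? T v)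
      rungs-leaf leaf = trans (sum-single _ j misses)
        (trans (ind-yes (incident? G _ _) hits) (sym (ind-yes (isLeaf? T v) leaf)))
        where
        j = Inverse.from leaves (v , leaf)
        hits : Incident G (V (b , v)) (E (inj₂ (Inverse.to leaves j)))
        hits = at⇒incident (inj₂ (Inverse.to leaves j)) (sym (cong proj₁ (Inverse.strictlyInverseˡ leaves (v , leaf))))
        leaf-≡ : ∀ {x : Σ (Fin n) (IsLeaf T)} → v ≡ proj₁ x → x ≡ (v , leaf)
        leaf-≡ refl = cong (v ,_) (leaf-irrelevant _ leaf)
        misses : ∀ i → i ≢ j → inc (inj₂ (Inverse.to leaves i)) ≡ 0
        misses i i≢j = ind-no (incident? G _ _) λ k → i≢j (trans (sym (Inverse.strictlyInverseʳ leaves i))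
          (cong (Inverse.from leaves) (leaf-≡ (incident⇒at (inj₂ (Inverse.to leaves i)) k))))

  -- Each copy of a leaf has degree 1 + 1, while a non-leaf keeps its degree, which is not 2 by
  -- hypothesis.
  degree-two-count : (∀ v → degree T v ≢ 2) → ∣V₂∣ G ≡ leafCount + leafCount
  degree-two-count ≢2 = trans (count≡sum (λ w → degree G w ℕ.≟ 2))
    (trans (sum-⊎ vertices↔ _) (cong₂ _+_ (sum-cong-≗ (two false)) (sum-cong-≗ (two true))))
    where
    leaf⇒two : ∀ b {v} → IsLeaf T v → degree G (V (b , v)) ≡ 2
    leaf⇒two b {v} leaf = trans (degree-doubled b v) (cong₂ _+_ leaf (ind-yes (isLeaf? T v) leaf))
    two⇒leaf : ∀ b {v} → degree G (V (b , v)) ≡ 2 → IsLeaf T v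
    two⇒leaf b {v} eq with isLeaf? T v
    ... | yes leaf = leaf
    ... | no ¬leaf = contradiction degree-two (≢2 v)
      where
      open ≡-Reasoning
      degree-two : degree T v ≡ 2
      degree-two = begin
        degree T v                      ≡⟨ ℕ.+-identityʳ _ ⟨
        degree T v + 0                  ≡⟨ cong (degree T v +_) (ind-no (isLeaf? T v) ¬leaf) ⟨
        degree T v + ind (isLeaf? T v)  ≡⟨ degree-doubled b v ⟨
        degree G (V (b , v))            ≡⟨ eq ⟩
        2                               ∎
    two : ∀ b v → ind (degree G (V (b , v)) ℕ.≟ 2) ≡ ind (isLeaf? T v)
    two b v = ind-cong (degree G (V (b , v)) ℕ.≟ 2) (isLeaf? T v) (two⇒leaf b) (leaf⇒two b)

-- Boolean identities, isomorphism invariants and existence of leaves.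

xor-≡ : ∀ {a b} → a xor b ≡ false → a ≡ b
xor-≡ {false} {false} _ = refl
xor-≡ {true}  {true}  _ = refl

≢⇒xor : ∀ {a b} → a ≢ b → a xor b ≡ true
≢⇒xor {false} {false} a≢b = contradiction refl a≢b
≢⇒xor {false} {true}  _   = refl
≢⇒xor {true}  {false} _   = refl
≢⇒xor {true}  {true}  a≢b = contradiction refl a≢b

xor-injective : ∀ a {b c} → a xor b ≡ a xor c → b ≡ c
xor-injective false eq = eq
xor-injective true  eq = not-injective eq

module _ {T : Graph n m} {H : Graph n′ m′} (iso : T ≅ H) where

  open _≅_ iso
  private
    φ = Inverse.to vertex
    ψ = Inverse.to edge

  -- The isomorphism transports joins forwards only. The converse holds since the image edge has no
  -- ends but the images of the ends of `e`, and `φ` is injective.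
  incident-iso⁻¹ : ∀ {v e} → Incident H (φ v) (ψ e) → Incident T v e
  incident-iso⁻¹ {v} {e} i =
    Sum.map φ-injective φ-injective (Incidence.incident⇒endpoint H (joins (Incidence.joins-ends T e)) i)
    where
    φ-injective : ∀ {x y} → φ x ≡ φ y → x ≡ y
    φ-injective {x} {y} eq = trans (sym (Inverse.strictlyInverseʳ vertex x))
      (trans (cong (Inverse.from vertex) eq) (Inverse.strictlyInverseʳ vertex y))

  degree-iso : ∀ v → degree T v ≡ degree H (φ v)
  degree-iso v = begin
    degree T v                                     ≡⟨ degree≡sum T v ⟩
    sum (λ e → ind (incident? T v e))              ≡⟨ sum-cong-≗ (λ e → ind-cong (incident? T v e) (incident? H _ _) incident-iso incident-iso⁻¹) ⟩
    sum (λ e → ind (incident? H (φ v) (ψ e)))      ≡⟨ sum-permute (λ f → ind (incident? H (φ v) f)) edge ⟨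
    sum (λ f → ind (incident? H (φ v) f))          ≡⟨ degree≡sum H (φ v) ⟨
    degree H (φ v)                                 ∎
    where
    open ≡-Reasoning
    incident-iso : ∀ {e} → Incident T v e → Incident H (φ v) (ψ e)
    incident-iso i = Incidence.joins⇒incidentˡ H (joins (proj₂ (Incidence.incident⇒joins T i)))

  leafCount-iso : sum (ind ∘ isLeaf? T) ≡ sum (ind ∘ isLeaf? H)
  leafCount-iso = trans
    (sum-cong-≗ (λ v → ind-cong (isLeaf? T v) (isLeaf? H (φ v)) (trans (sym (degree-iso v))) (trans (degree-iso v))))
    (sym (sum-permute (ind ∘ isLeaf? H) vertex))

-- Every tip is a leaf, and the bound on `p` keeps the centre from being one.
star-leafCount : {T : Graph n m} {p : ℕ} → 2 ≤ p → T ≅ K₁, p → sum (ind ∘ isLeaf? T) ≡ p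
star-leafCount {T = T} {p} 2≤p iso = trans (leafCount-iso iso)
  (cong₂ _+_ (ind-no (isLeaf? K zero) λ eq → ℕ.<⇒≢ 2≤p (trans (sym eq) centre))
             (trans (sum-cong-≗ (λ i → ind-yes (isLeaf? K (suc i)) (tip i))) (trans (sum-const p 1) (ℕ.*-identityʳ p))))
  where
  K = K₁, p
  centre : degree K zero ≡ p
  centre = trans (degree≡sum K zero)
    (trans (sum-cong-≗ (λ i → ind-yes (incident? K zero i) (inj₁ refl))) (trans (sum-const p 1) (ℕ.*-identityʳ p)))
  tip : ∀ i → IsLeaf K (suc i)
  tip i = trans (degree≡sum K (suc i))
    (trans (sum-cong-≗ (λ j → ind-cong (incident? K (suc i) j) (j ≟ i) (λ { (inj₂ refl) → refl }) (λ { refl → inj₂ refl })))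
           (sum-ind-≡ i))

walk-map : {T : Graph n m} {G : Graph n′ m′} (f : Fin n → Fin n′) →
           (∀ {e u v} → Joins T e u v → ∃ λ e′ → Joins G e′ (f u) (f v)) →
           ∀ {u v} → Walk T u v → Walk G (f u) (f v)
walk-map f step nil          = nil
walk-map f step (cons e j w) = cons _ (proj₂ (step j)) (walk-map f step w)

-- Without leaves all degrees would be at least 2, and the handshake lemma would give n ≤ m, against
-- m + 1 = n.
leaf-exists : (T : Graph n m) → IsTree T → 2 ≤ n → ∃ (IsLeaf T)
leaf-exists {n} {m} T isTree 2≤n@(s≤s _) with any? (isLeaf? T)
... | yes found = found
... | no  ¬any  = contradiction too-many (ℕ.<⇒≱ (ℕ.*-monoˡ-< 2 (ℕ.≤-reflexive (Cuts.Rooted.size T isTree zero))))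
  where
  degree≥2 : ∀ v → 2 ≤ degree T v
  degree≥2 v = ℕ.≤∧≢⇒< (degree-positive T (proj₂ (incident-edge T (proj₁ isTree) 2≤n v)))
                       (λ eq → ¬any (v , sym eq))
  too-many : n * 2 ≤ m * 2
  too-many = subst₂ _≤_ (sum-const n 2) (handshake T) (sum-mono degree≥2)

-- The graph of a Halin tree: matching covered, bipartite and minimal.

module HalinDoubling {T : Graph n m} {G : Graph n′ m′} (halin : IsHalinTree T) (D : Doubling T G) where

  open IsHalinTree halin
  open Doubling D
  open Doubled D
  open Cuts T tree
  open TreeMatching T tree
  private
    module GI = Incidence G
    module TI = Incidence T

  some-vertex : Fin n
  some-vertex = proj₁ (leaf-exists T tree twoVertices)

  order-tree : suc m ≡ n
  order-tree = Rooted.size some-vertex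

  connected : Connected G
  connected = every-vertex _ λ (b , u) → every-vertex _ λ (c , v) → join b c u v
    where
    copy : ∀ b u v → Walk G (V (b , u)) (V (b , v))
    copy b u v = walk-map (λ x → V (b , x)) (λ j → _ , joins-copy b j) (proj₁ tree u v)
    join : ∀ b c u v → Walk G (V (b , u)) (V (c , v))
    join b c u v with leaf-exists T tree twoVertices
    join false false u v | _ = copy false u v
    join true  true  u v | _ = copy true u v
    join false true  u v | x , leaf = copy false u x GI.++ʷ cons _ (joins-rung leaf) (copy true x v)
    join true  false u v | x , leaf = copy true u x GI.++ʷ cons _ (GI.joins-sym (joins-rung leaf)) (copy false x v)

  -- For a tree edge, a matching through it is mirrored. For a rung, the mirrored matching misses
  -- the leaf, so that the rung is added.
  perfect-through : ∀ x → ∃ λ M → Perfect G M × M (E x) ≡ true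
  perfect-through (inj₁ (b , e)) with matching-through e
  ... | M , near , Me = mirrored near ∘ Inverse.from edge , mirrored-perfect near ,
    trans (cong (mirrored near) (Inverse.strictlyInverseʳ edge _)) Me
  perfect-through (inj₂ (v , leaf)) with matching-missing leaf (proj₂ (incident-edge T (proj₁ tree) twoVertices v))
  ... | M , near , missed = mirrored near ∘ Inverse.from edge , mirrored-perfect near ,
    trans (cong (mirrored near) (Inverse.strictlyInverseʳ edge _)) (mirrored-rung near leaf missed)

  matchingCovered : MatchingCovered G
  matchingCovered = record
    { fourVertices = subst (4 ≤_) (sym order) (ℕ.+-mono-≤ twoVertices twoVertices)
    ; connected    = connected
    ; covered      = every-edge _ covered
    }
    where
    covered : ∀ x → ∃ λ N → IsPerfectMatching G N × E x ∈ N
    covered x with perfect-through x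
    ... | M , perfect , Mx =
      Vec.tabulate M , perfect⇒isPerfectMatching G perfect , lookup⇒[]= (E x) _ (trans (lookup∘tabulate M (E x)) Mx)

  colour : Fin n → Bool
  colour v = 𝔽₂.sum (λ e → side e v)

  -- Crossing the edge e changes the side of e and of no other edge.
  colour-differs : ∀ {e u v} → Joins T e u v → colour u ≢ colour v
  colour-differs {e} {u} {v} j eq = contradiction
    (trans (sym flips) (trans (cong (colour u xor_) (sym eq)) (xor-same (colour u)))) λ ()
    where
    open ≡-Reasoning
    same : ∀ f → f ≢ e → side f u xor side f v ≡ false
    same f f≢e = trans (cong (side f u xor_) (sym (side-same f≢e j))) (xor-same (side f u))
    flips : colour u xor colour v ≡ true
    flips = begin
      colour u xor colour v                       ≡⟨ 𝔽₂.∑-distrib-+ (λ f → side f u) (λ f → side f v) ⟨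
      𝔽₂.sum (λ f → side f u xor side f v)        ≡⟨ 𝔽₂.sum-single _ e same ⟩
      side e u xor side e v                       ≡⟨ ≢⇒xor (side-differs j) ⟩
      true                                        ∎

  -- Bridges the labelling of G by two copies of T and the stored ends of its edges, both for
  -- equality (no crossing) and for inequality (proper colouring).
  ends-related : (R : Bool → Bool → Set) → (∀ {a b} → R a b → R b a) → (c : Bool × Fin n → Bool) →
                 ∀ {e x y} → Joins G e (V x) (V y) → R (c x) (c y) →
                 R (c (Inverse.from vertex (proj₁ (ends G e)))) (c (Inverse.from vertex (proj₂ (ends G e))))
  ends-related R R-sym c {x = x} {y} j r =
    GI.symmetric-on-ends (λ u v → R (c (Inverse.from vertex u)) (c (Inverse.from vertex v))) R-sym j
      (subst₂ (λ x′ y′ → R (c x′) (c y′)) (sym (Inverse.strictlyInverseʳ vertex x)) (sym (Inverse.strictlyInverseʳ vertex y)) r)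

  bipartite : Bipartite G
  bipartite = colourOf ∘ Inverse.from vertex , every-edge _ proper
    where
    colourOf : Bool × Fin n → Bool
    -- The second copy is coloured oppositely, so that rungs join different colours.
    colourOf (b , v) = b xor colour v
    proper : ∀ x → colourOf (Inverse.from vertex (proj₁ (ends G (E x)))) ≢ colourOf (Inverse.from vertex (proj₂ (ends G (E x))))
    proper (inj₁ (b , e)) = ends-related _≢_ (_∘ sym) colourOf (joins-copy b j)
      (colour-differs j ∘ xor-injective b)
      where j = TI.joins-ends e
    proper (inj₂ (v , leaf)) = ends-related _≢_ (_∘ sym) colourOf (joins-rung leaf) (not-¬ refl)

  -- Without an edge e of one copy, its twin h is the only edge leaving a vertex
  -- set that consists of the same side of e in both copies and so is even.
  minimal-copy : ∀ b e → ¬ MatchingCovered (delete G (E (inj₁ (b , e))))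
  minimal-copy b e covered with delete-covered G _ covered (E (inj₁ (not b , e))) (not-¬ refl ∘ sym ∘ copy-≡ ∘ E-injective)
    where
    copy-≡ : ∀ {b c} {e f : Fin m} → _≡_ {A = EdgeOf} (inj₁ (b , e)) (inj₁ (c , f)) → b ≡ c
    copy-≡ refl = refl
  ... | M , perfect , Mg , Mh = crosses (xor-≡ (trans (sym (single-crossing-edge G perfect s h Mh (every-edge _ within))) even))
    where
    h = E (inj₁ (not b , e))
    sideOf : Bool × Fin n → Bool
    sideOf (_ , v) = side e v
    s : Fin n′ → Bool
    s = sideOf ∘ Inverse.from vertex
    crosses : s (proj₁ (ends G h)) ≢ s (proj₂ (ends G h))
    crosses = ends-related _≢_ (_∘ sym) sideOf (joins-copy (not b) j) (side-differs j)
      where j = TI.joins-ends e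
    within : ∀ x → E x ≢ h → M (E x) ≡ true → s (proj₁ (ends G (E x))) ≡ s (proj₂ (ends G (E x)))
    within (inj₂ (v , leaf)) _ _ = ends-related _≡_ sym sideOf (joins-rung leaf) refl
    within (inj₁ (c , f)) ≢h Mf with e ≟ f | c ≟ᵇ b
    ... | no e≢f   | _        = ends-related _≡_ sym sideOf (joins-copy c j) (side-same e≢f j)
      where j = TI.joins-ends f
    ... | yes refl | yes refl = contradiction (trans (sym Mf) Mg) λ ()
    ... | yes refl | no c≢b   = contradiction (cong (λ a → E (inj₁ (a , e))) (¬-not c≢b)) ≢h
    even : 𝔽₂.sum s ≡ false
    even = trans (𝔽₂.sum-⊎ vertices↔ s) (trans (cong₂ _xor_ (half false) (half true)) (xor-same (𝔽₂.sum (side e))))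
      where
      half : ∀ c → 𝔽₂.sum (λ v → s (V (c , v))) ≡ 𝔽₂.sum (side e)
      half c = 𝔽₂.sum-cong-≗ (λ v → cong sideOf (Inverse.strictlyInverseʳ vertex (c , v)))

  -- A leaf has its rung, any other vertex a second tree edge.
  another-edge-at : ∀ {u e} → Incident T u e → ∃ λ x → x ≢ inj₁ (false , e) × x at (false , u)
  another-edge-at {u} {e} i with isLeaf? T u
  ... | yes leaf = inj₂ (u , leaf) , (λ ()) , refl
  ... | no ¬leaf with another-edge T ¬leaf i
  ...   | f , f≢e , j = inj₁ (false , f) , (λ { refl → f≢e refl }) , (refl , j)

  -- Without its rung a leaf has only one edge left, so no other edge at its
  -- neighbour is in a perfect matching.
  minimal-rung : ∀ v leaf → ¬ MatchingCovered (delete G (E (inj₂ (v , leaf))))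
  minimal-rung v leaf covered with incident-edge T (proj₁ tree) twoVertices v
  ... | e , i with TI.incident⇒joins i
  ...   | u , j with another-edge-at (TI.joins⇒incidentʳ j)
  ...     | x , x≢e , x-at-u with delete-covered G _ covered (E x) (not-rung ∘ E-injective)
    where
    not-rung : x ≢ inj₂ (v , leaf)
    not-rung refl = TI.joins⇒≢ j (sym x-at-u)
  ...       | M , perfect , Mg , Mx with perfect (V (false , v)) | perfect (V (false , u))
  ...         | h , (Mh , h-at-v) , _ | k , _ , unique =
    not-at-leaf (Inverse.from edge h) (trans (cong M (Inverse.strictlyInverseˡ edge h)) Mh)
      (incident⇒at _ (subst (Incident G _) (sym (Inverse.strictlyInverseˡ edge h)) h-at-v))
    where
    not-at-leaf : ∀ z → M (E z) ≡ true → ¬ z at (false , v)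
    not-at-leaf (inj₂ (_ , leaf′)) Mz refl =
      contradiction (trans (sym Mz) (trans (cong (λ l → M (E (inj₂ (v , l)))) (leaf-irrelevant leaf′ leaf)) Mg)) λ ()
    not-at-leaf (inj₁ (_ , f)) Mz (refl , f-at-v) with leaf-edge-unique T leaf f-at-v i
    -- The leaf is matched along `e`, so `e` is also the matching edge at its neighbour, where `x`
    -- was forced.
    ... | refl = x≢e (E-injective (trans (sym (unique (Mx , at⇒incident x x-at-u)))
      (unique (Mz , at⇒incident (inj₁ (false , e)) (refl , TI.joins⇒incidentʳ j)))))

  minimalBipartite : MinimalBipartiteMatchingCovered G
  minimalBipartite = record
    { matchingCovered = matchingCovered
    ; minimal         = every-edge _ λ { (inj₁ (b , e)) → minimal-copy b e ; (inj₂ (v , leaf)) → minimal-rung v leaf }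
    ; bipartite       = bipartite
    }

  -- Extremality by counting leaves.

  degree-two : ∣V₂∣ G ≡ leafCount + leafCount
  degree-two = degree-two-count noDegreeTwo

  -- With L leaves, m′ = 2m + L and n′ = 2(m + 1), so m′ - n′ + 2 = L, and there are 2L vertices of
  -- degree two.
  twoVertexExtremal : TwoVertexExtremal G
  twoVertexExtremal = begin
    ℤ.+ ∣V₂∣ G
      ≡⟨ cong ℤ.+_ degree-two ⟩
    ℤ.+ L ℤ.+ ℤ.+ L
      ≡⟨ identity (ℤ.+ m) (ℤ.+ L) ⟩
    ℤ.+ 2 ℤ.* ((ℤ.+ m ℤ.+ ℤ.+ m ℤ.+ ℤ.+ L) ℤ.- ((ℤ.+ 1 ℤ.+ ℤ.+ m) ℤ.+ (ℤ.+ 1 ℤ.+ ℤ.+ m)) ℤ.+ ℤ.+ 2)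
      ≡⟨ cong₂ (λ a b → ℤ.+ 2 ℤ.* (ℤ.+ a ℤ.- ℤ.+ b ℤ.+ ℤ.+ 2)) size (trans order (cong₂ _+_ (sym order-tree) (sym order-tree))) ⟨
    ℤ.+ 2 ℤ.* (ℤ.+ m′ ℤ.- ℤ.+ n′ ℤ.+ ℤ.+ 2) ∎
    where
    open ≡-Reasoning
    L = leafCount
    identity : ∀ a l → l ℤ.+ l ≡ ℤ.+ 2 ℤ.* ((a ℤ.+ a ℤ.+ l) ℤ.- ((ℤ.+ 1 ℤ.+ a) ℤ.+ (ℤ.+ 1 ℤ.+ a)) ℤ.+ ℤ.+ 2)
    identity = ℤ-Solver.solve-∀

  -- A leaf has 1 + 2 = 3 and a non-leaf 3 + 0 = 3, so counting each leaf twice on top of its degree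
  -- gives 2m + 2L = 3n, where m + 1 = n.
  cubic-leafCount : IsCubic T → leafCount + leafCount ≡ n + 2
  cubic-leafCount cubic = ℕ.+-cancelʳ-≡ (m * 2) _ _ (begin
    (L + L) + m * 2                                             ≡⟨ ℕ.+-comm (L + L) _ ⟩
    m * 2 + (L + L)                                             ≡⟨ cong₂ _+_ (handshake T) (∑-distrib-+ (ind ∘ isLeaf? T) (ind ∘ isLeaf? T)) ⟨
    sum (degree T) + sum (λ v → ind (isLeaf? T v) + ind (isLeaf? T v))
                                                                ≡⟨ ∑-distrib-+ (degree T) _ ⟨
    sum (λ v → degree T v + (ind (isLeaf? T v) + ind (isLeaf? T v))) ≡⟨ sum-cong-≗ three ⟩
    sum {n} (λ _ → 3)                                           ≡⟨ sum-const n 3 ⟩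
    n * 3                                                       ≡⟨ cong (_* 3) order-tree ⟨
    suc m * 3                                                   ≡⟨ identity m ⟩
    (suc m + 2) + m * 2                                         ≡⟨ cong (λ k → (k + 2) + m * 2) order-tree ⟩
    (n + 2) + m * 2                                             ∎)
    where
    open ≡-Reasoning
    L = leafCount
    identity : ∀ a → suc a * 3 ≡ (suc a + 2) + a * 2
    identity = ℕ-Solver.solve-∀
    three : ∀ v → degree T v + (ind (isLeaf? T v) + ind (isLeaf? T v)) ≡ 3
    three v = Sum.[ (λ leaf → cong₂ (λ d i → d + (i + i)) leaf (ind-yes (isLeaf? T v) leaf))
                  , (λ ¬leaf → cong₂ (λ d i → d + (i + i)) (cubic v ¬leaf) (ind-no (isLeaf? T v) ¬leaf)) ]′
                  (toSum (isLeaf? T v))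

  twoVertexNExtremal : IsCubic T → TwoVertexNExtremal G
  -- Equality of unnormalised fractions is cross-multiplication, whence the factors 2 and 1; the
  -- claim reduces to 2L = n + 2 through n′ = 2n.
  twoVertexNExtremal cubic = *≡* (begin
    ℤ.+ ∣V₂∣ G ℤ.* ℤ.+ 2
      ≡⟨ cong (λ k → ℤ.+ k ℤ.* ℤ.+ 2) (trans degree-two (cubic-leafCount cubic)) ⟩
    (ℤ.+ n ℤ.+ ℤ.+ 2) ℤ.* ℤ.+ 2
      ≡⟨ identity (ℤ.+ n) ⟩
    ((ℤ.+ n ℤ.+ ℤ.+ n) ℤ.* ℤ.+ 1 ℤ.+ ℤ.+ 2 ℤ.* ℤ.+ 2) ℤ.* ℤ.+ 1
      ≡⟨ cong (λ k → (ℤ.+ k ℤ.* ℤ.+ 1 ℤ.+ ℤ.+ 2 ℤ.* ℤ.+ 2) ℤ.* ℤ.+ 1) order ⟨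
    (ℤ.+ n′ ℤ.* ℤ.+ 1 ℤ.+ ℤ.+ 2 ℤ.* ℤ.+ 2) ℤ.* ℤ.+ 1 ∎)
    where
    open ≡-Reasoning
    identity : ∀ a → (a ℤ.+ ℤ.+ 2) ℤ.* ℤ.+ 2 ≡ ((a ℤ.+ a) ℤ.* ℤ.+ 1 ℤ.+ ℤ.+ 2 ℤ.* ℤ.+ 2) ℤ.* ℤ.+ 1
    identity = ℤ-Solver.solve-∀

  -- A star has p edges, p leaves and p + 1 vertices, so m′ = 3p and 3n′ - 6 = 6p.
  edgeExtremal : IsStar T → EdgeExtremal G
  edgeExtremal (p , 2≤p , iso) = *≡* (begin
    ℤ.+ m′ ℤ.* ℤ.+ 2
      ≡⟨ cong (λ k → ℤ.+ k ℤ.* ℤ.+ 2) (trans size (cong₂ (λ a l → (a + a) + l) (↔⇒≡ (_≅_.edge iso)) (star-leafCount 2≤p iso))) ⟩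
    (ℤ.+ p ℤ.+ ℤ.+ p ℤ.+ ℤ.+ p) ℤ.* ℤ.+ 2
      ≡⟨ identity (ℤ.+ p) ⟩
    (ℤ.+ 3 ℤ.* ((ℤ.+ 1 ℤ.+ ℤ.+ p) ℤ.+ (ℤ.+ 1 ℤ.+ ℤ.+ p)) ℤ.- ℤ.+ 6) ℤ.* ℤ.+ 1
      ≡⟨ cong (λ k → (ℤ.+ 3 ℤ.* ℤ.+ k ℤ.- ℤ.+ 6) ℤ.* ℤ.+ 1) (trans order (cong (λ k → k + k) (↔⇒≡ (_≅_.vertex iso)))) ⟨
    (ℤ.+ 3 ℤ.* ℤ.+ n′ ℤ.- ℤ.+ 6) ℤ.* ℤ.+ 1 ∎)
    where
    open ≡-Reasoning
    identity : ∀ a → (a ℤ.+ a ℤ.+ a) ℤ.* ℤ.+ 2 ≡ (ℤ.+ 3 ℤ.* ((ℤ.+ 1 ℤ.+ a) ℤ.+ (ℤ.+ 1 ℤ.+ a)) ℤ.- ℤ.+ 6) ℤ.* ℤ.+ 1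
    identity = ℤ-Solver.solve-∀

theorem1p8 : ∀ {n m n′ m′ : ℕ} (T : Graph n m) (G : Graph n′ m′) →
    IsHalinTree T → IsomorphicLeafMatching T G →
    MinimalBipartiteMatchingCovered G × TwoVertexExtremal G ×
    (IsCubic T → TwoVertexNExtremal G) ×
    (IsStar T → EdgeExtremal G)
theorem1p8 T G halin matching = minimalBipartite , twoVertexExtremal , twoVertexNExtremal , edgeExtremal
  where open HalinDoubling halin (doubling matching)
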